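{- Let $n<\omega$ and let $\mathfrak D\in\mathsf{QEA}_\omega$ be atomic and such that for all $x\in\mathfrak D$ and all $k<\omega$, $\mathsf c_kx=\sum_{l\in\omega}\mathsf s^k_lx$. If $\mathfrak A\subseteq\mathfrak{Nr}_n\mathfrak D$ and $\mathfrak A\subseteq_c\mathfrak D$, then $\mathfrak A$ is completely representable.
   Context: $\mathsf{QEA}_\omega$ is the class of $\omega$-dimensional quasi-polyadic equality algebras: the signature of polyadic equality algebras restricted to cylindrifications on finitely many indices and substitutions $\mathsf s_\tau$ only for finite transformations $\tau:\omega\to\omega$ (moving finitely many points), with diagonals $\mathsf d_{ij}$, axiomatized by the corresponding restriction of the polyadic equality axioms. $\mathsf s^k_l$ is the substitution corresponding to the map sending $k$ to $l$ and fixing all other points. $\mathfrak{Nr}_n\mathfrak D$ has universe $\{x:\mathsf c_ix=x\ \forall i\in\omega\setminus n\}$ with operations indexed in $n$. $\mathfrak A\subseteq_c\mathfrak D$ means $\mathfrak A$ is a subalgebra and every $X\subseteq A$ with $\sum^{\mathfrak A}X=1$ has $\sum^{\mathfrak D}X=1$. Completely representable: there is an isomorphism $f$ from $\mathfrak A$ onto a set algebra (concrete operations) whose unit is a disjoint union of cartesian spaces ${}^nU_i$, with $f(\sum X)=\bigcup_{x\in X}f(x)$ whenever $\sum X$ exists. -}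

module Defs where

open import Level using (Level; _⊔_) renaming (suc to lsuc)
open import Algebra.Lattice.Structures using (IsBooleanAlgebra)
open import Data.Empty using (⊥-elim)
open import Data.Empty.Polymorphic using (⊥)
open import Data.Fin.Base using (Fin; toℕ; fromℕ<)
open import Data.List.Base using (List; []; [_]; _++_; map; upTo)
open import Data.List.Membership.Propositional using (_∈_; _∉_)
open import Data.List.Membership.Propositional.Properties using (∈-upTo⁺; ∈-++⁺ˡ; ∈-++⁺ʳ)
open import Data.List.Relation.Binary.Subset.Propositional using (_⊆_)
open import Data.List.Relation.Unary.Any using (here)
open import Data.Nat.Base using (ℕ; _≤_)
open import Data.Nat.Properties using (_≟_; _<?_)
open import Data.Product.Base using (Σ; ∃; _×_; _,_; proj₁; proj₂)
open import Data.Sum.Base using (_⊎_)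
open import Data.Unit.Polymorphic.Base using (⊤)
open import Data.Vec.Base using (Vec; lookup; tabulate)
open import Function.Base using (id; _∘_)
open import Function.Bundles using (_⇔_)
open import Function.Definitions using (Congruent; Injective; Surjective)
open import Relation.Binary.PropositionalEquality using (_≡_; refl; trans; cong; _≗_)
open import Relation.Nullary.Decidable.Core using (yes; no)
open import Relation.Nullary.Negation.Core using (¬_)
open import Relation.Unary using (Pred; _∪_; _∩_; ∁; _≐_)
import Relation.Unary as Unary

private
  variable
    c ℓ c₁ ℓ₁ c₂ ℓ₂ : Level

record FinTrans (I : Set) : Set where
  field
    fun     : I → I
    support : List I
    fixes   : ∀ i → i ∉ support → fun i ≡ i

open FinTrans public

idT : ∀ {I} → FinTrans I
idT = record { fun = id ; support = [] ; fixes = λ _ _ → refl }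

infixr 9 _∘T_
_∘T_ : ∀ {I} → FinTrans I → FinTrans I → FinTrans I
σ ∘T τ = record
  { fun     = fun σ ∘ fun τ
  ; support = support σ ++ support τ
  ; fixes   = λ i i∉ → trans
      (cong (fun σ) (fixes τ i (i∉ ∘ ∈-++⁺ʳ (support σ))))
      (fixes σ i (i∉ ∘ ∈-++⁺ˡ))
  }

replaceFun : ℕ → ℕ → ℕ → ℕ
replaceFun k l i with i ≟ k
... | yes _ = l
... | no  _ = i

[_/_] : ℕ → ℕ → FinTrans ℕ
[ k / l ] = record { fun = replaceFun k l ; support = [ k ] ; fixes = fixed }
  where
  fixed : ∀ i → i ∉ [ k ] → replaceFun k l i ≡ i
  fixed i i∉ with i ≟ k
  ... | yes i≡k = ⊥-elim (i∉ (here i≡k))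
  ... | no  _   = refl

extendFun : ∀ {n} → (Fin n → Fin n) → ℕ → ℕ
extendFun {n} f i with i <? n
... | yes i<n = toℕ (f (fromℕ< i<n))
... | no  _   = i

-- A transformation of n = {0,…,n-1}, extended to ω by the identity.
extend : ∀ {n} → FinTrans (Fin n) → FinTrans ℕ
extend {n} τ = record { fun = extendFun (fun τ) ; support = upTo n ; fixes = fixed }
  where
  fixed : ∀ i → i ∉ upTo n → extendFun (fun τ) i ≡ i
  fixed i i∉ with i <? n
  ... | yes i<n = ⊥-elim (i∉ (∈-upTo⁺ i<n))
  ... | no  _   = refl

-- A finite set Γ of indices is given by a list enumerating it.
record RawAlgebra (I : Set) (c ℓ : Level) : Set (lsuc (c ⊔ ℓ)) where
  infix  4 _≈_ _≤ᴬ_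
  infixr 6 _+_
  infixr 7 _·_
  field
    Carrier : Set c
    _≈_     : Carrier → Carrier → Set ℓ
    _+_     : Carrier → Carrier → Carrier
    _·_     : Carrier → Carrier → Carrier
    -_      : Carrier → Carrier
    𝟙       : Carrier
    𝟘       : Carrier
    cyl     : List I → Carrier → Carrier
    sub     : FinTrans I → Carrier → Carrier
    diag    : I → I → Carrier

  _≤ᴬ_ : Carrier → Carrier → Set ℓ
  x ≤ᴬ y = x · y ≈ x

  IsSum : ∀ {p} → Pred Carrier p → Carrier → Set (c ⊔ ℓ ⊔ p)
  IsSum X b = (∀ x → X x → x ≤ᴬ b) × (∀ u → (∀ x → X x → x ≤ᴬ u) → b ≤ᴬ u)

  IsAtom : Carrier → Set (c ⊔ ℓ)
  IsAtom a = ¬ (a ≈ 𝟘) × (∀ x → x ≤ᴬ a → x ≈ 𝟘 ⊎ x ≈ a)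

  Atomic : Set (c ⊔ ℓ)
  Atomic = ∀ x → ¬ (x ≈ 𝟘) → ∃ λ a → IsAtom a × a ≤ᴬ x

-- QEA_ω: the polyadic equality axioms (Henkin–Monk–Tarski, Part II, §5.4),
-- with Γ, Δ finite and σ, τ finite transformations.
record IsQEAω (𝔇 : RawAlgebra ℕ c ℓ) : Set (c ⊔ ℓ) where
  open RawAlgebra 𝔇
  field
    isBooleanAlgebra : IsBooleanAlgebra _≈_ _+_ _·_ -_ 𝟙 𝟘

    -- The operations depend only on the set enumerated by Γ and on the
    -- underlying function of τ.
    cyl-cong : ∀ {Γ Δ x y} → Γ ⊆ Δ → Δ ⊆ Γ → x ≈ y → cyl Γ x ≈ cyl Δ y
    sub-cong : ∀ {σ τ x y} → fun σ ≗ fun τ → x ≈ y → sub σ x ≈ sub τ y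

    cyl-𝟘     : ∀ Γ → cyl Γ 𝟘 ≈ 𝟘
    cyl-incr  : ∀ Γ x → x ≤ᴬ cyl Γ x
    cyl-·     : ∀ Γ x y → cyl Γ (x · cyl Γ y) ≈ cyl Γ x · cyl Γ y
    cyl-empty : ∀ x → cyl [] x ≈ x
    cyl-union : ∀ Γ Δ x → cyl Γ (cyl Δ x) ≈ cyl (Γ ++ Δ) x

    sub-+   : ∀ τ x y → sub τ (x + y) ≈ sub τ x + sub τ y
    sub-neg : ∀ τ x → sub τ (- x) ≈ - sub τ x
    sub-id  : ∀ x → sub idT x ≈ x
    sub-∘   : ∀ σ τ x → sub (σ ∘T τ) x ≈ sub σ (sub τ x)

    sub-cyl : ∀ σ τ Γ x → (∀ i → i ∉ Γ → fun σ i ≡ fun τ i) →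
              sub σ (cyl Γ x) ≈ sub τ (cyl Γ x)
    cyl-sub : ∀ τ Γ Δ x → (∀ i → i ∈ Δ ⇔ fun τ i ∈ Γ) →
              (∀ i j → i ∈ Δ → j ∈ Δ → fun τ i ≡ fun τ j → i ≡ j) →
              cyl Γ (sub τ x) ≈ sub τ (cyl Δ x)

    diag-refl : ∀ i → diag i i ≈ 𝟙
    diag-sub  : ∀ i j x → x · diag i j ≤ᴬ sub [ i / j ] x
    sub-diag  : ∀ τ i j → sub τ (diag i j) ≈ diag (fun τ i) (fun τ j)

record QEAω (c ℓ : Level) : Set (lsuc (c ⊔ ℓ)) where
  field
    rawAlgebra : RawAlgebra ℕ c ℓ
    isQEAω     : IsQEAω rawAlgebra

  open RawAlgebra rawAlgebra public
  open IsQEAω isQEAω public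

CylIsSumOfSubs : QEAω c ℓ → Set (c ⊔ ℓ)
CylIsSumOfSubs 𝔇 = ∀ x k → IsSum (λ y → ∃ λ l → y ≈ sub [ k / l ] x) (cyl [ k ] x)
  where open QEAω 𝔇

record Subalgebra {I : Set} (𝔅 : RawAlgebra I c ℓ) (p : Level) : Set (c ⊔ ℓ ⊔ lsuc p) where
  open RawAlgebra 𝔅
  field
    Universe    : Pred Carrier p
    respects    : ∀ {x y} → x ≈ y → Universe x → Universe y
    +-closed    : ∀ {x y} → Universe x → Universe y → Universe (x + y)
    ·-closed    : ∀ {x y} → Universe x → Universe y → Universe (x · y)
    neg-closed  : ∀ {x} → Universe x → Universe (- x)
    𝟙-closed    : Universe 𝟙
    𝟘-closed    : Universe 𝟘
    cyl-closed  : ∀ Γ {x} → Universe x → Universe (cyl Γ x)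
    sub-closed  : ∀ τ {x} → Universe x → Universe (sub τ x)
    diag-closed : ∀ i j → Universe (diag i j)

  algebra : RawAlgebra I (c ⊔ p) ℓ
  algebra = record
    { Carrier = Σ Carrier Universe
    ; _≈_     = λ x y → proj₁ x ≈ proj₁ y
    ; _+_     = λ x y → proj₁ x + proj₁ y , +-closed (proj₂ x) (proj₂ y)
    ; _·_     = λ x y → proj₁ x · proj₁ y , ·-closed (proj₂ x) (proj₂ y)
    ; -_      = λ x → - proj₁ x , neg-closed (proj₂ x)
    ; 𝟙       = 𝟙 , 𝟙-closed
    ; 𝟘       = 𝟘 , 𝟘-closed
    ; cyl     = λ Γ x → cyl Γ (proj₁ x) , cyl-closed Γ (proj₂ x)
    ; sub     = λ τ x → sub τ (proj₁ x) , sub-closed τ (proj₂ x)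
    ; diag    = λ i j → diag i j , diag-closed i j
    }

-- For a subalgebra 𝔄 of 𝔅, this says that 𝔄 ⊆_c 𝔅.
IsCompleteSubalgebra : ∀ {I : Set} {𝔅 : RawAlgebra I c ℓ} {p} →
                       Subalgebra 𝔅 p → Set (c ⊔ ℓ ⊔ lsuc p)
IsCompleteSubalgebra {𝔅 = 𝔅} {p = p} 𝔄 =
  (X : Pred 𝔅.Carrier p) → X Unary.⊆ Universe →
  𝔄.IsSum (X ∘ proj₁) 𝔄.𝟙 → 𝔅.IsSum X 𝔅.𝟙
  where
  open Subalgebra 𝔄 using (Universe; algebra)
  module 𝔅 = RawAlgebra 𝔅
  module 𝔄 = RawAlgebra algebra

-- The operations of 𝔇 indexed in n, on the whole carrier of 𝔇.
reduct : (n : ℕ) → QEAω c ℓ → RawAlgebra (Fin n) c ℓ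
reduct n 𝔇 = record
  { Carrier = Carrier
  ; _≈_     = _≈_
  ; _+_     = _+_
  ; _·_     = _·_
  ; -_      = -_
  ; 𝟙       = 𝟙
  ; 𝟘       = 𝟘
  ; cyl     = λ Γ → cyl (map toℕ Γ)
  ; sub     = λ τ → sub (extend τ)
  ; diag    = λ i j → diag (toℕ i) (toℕ j)
  }
  where open QEAω 𝔇

-- The universe of 𝔑𝔯_n 𝔇.  The operations of 𝔑𝔯_n 𝔇 are those of reduct n 𝔇,
-- so a subalgebra of 𝔑𝔯_n 𝔇 is a subalgebra of reduct n 𝔇 contained in Nr n 𝔇.
Nr : (n : ℕ) (𝔇 : QEAω c ℓ) → Pred (QEAω.Carrier 𝔇) ℓ
Nr n 𝔇 x = ∀ i → n ≤ i → cyl [ i ] x ≈ x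
  where open QEAω 𝔇

record IsIsomorphism {I : Set} (𝔄 : RawAlgebra I c₁ ℓ₁) (𝔅 : RawAlgebra I c₂ ℓ₂)
                     (f : RawAlgebra.Carrier 𝔄 → RawAlgebra.Carrier 𝔅) :
                     Set (c₁ ⊔ ℓ₁ ⊔ c₂ ⊔ ℓ₂) where
  private
    module 𝔄 = RawAlgebra 𝔄
    module 𝔅 = RawAlgebra 𝔅
  field
    congruent  : Congruent 𝔄._≈_ 𝔅._≈_ f
    injective  : Injective 𝔄._≈_ 𝔅._≈_ f
    surjective : Surjective 𝔄._≈_ 𝔅._≈_ f
    +-homo     : ∀ x y → f (x 𝔄.+ y) 𝔅.≈ (f x 𝔅.+ f y)
    ·-homo     : ∀ x y → f (x 𝔄.· y) 𝔅.≈ (f x 𝔅.· f y)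
    neg-homo   : ∀ x → f (𝔄.- x) 𝔅.≈ (𝔅.- f x)
    𝟙-homo     : f 𝔄.𝟙 𝔅.≈ 𝔅.𝟙
    𝟘-homo     : f 𝔄.𝟘 𝔅.≈ 𝔅.𝟘
    cyl-homo   : ∀ Γ x → f (𝔄.cyl Γ x) 𝔅.≈ 𝔅.cyl Γ (f x)
    sub-homo   : ∀ τ x → f (𝔄.sub τ x) 𝔅.≈ 𝔅.sub τ (f x)
    diag-homo  : ∀ i j → f (𝔄.diag i j) 𝔅.≈ 𝔅.diag i j

-- The disjoint union of the cartesian spaces ⁿBⱼ.  The union is tagged, so that
-- it is disjoint also for n = 0, where every ⁿBⱼ consists of the empty tuple.
Space : (n : ℕ) {J : Set ℓ} → (J → Set ℓ) → Set ℓ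
Space n {J} B = Σ J λ j → Vec (B j) n

-- All subsets of the unit, with the concrete operations.  Cylindrification stays
-- inside a summand.  For n ≥ 2 and pairwise disjoint Bⱼ this is automatic for
-- singleton Γ, since points differing in one coordinate share another one, and
-- cyl Γ is the composition of the cylindrifications at the elements of Γ.
fullSetAlgebra : (n : ℕ) {J : Set ℓ} → (J → Set ℓ) → RawAlgebra (Fin n) (lsuc ℓ) ℓ
fullSetAlgebra {ℓ} n B = record
  { Carrier = Pred (Space n B) ℓ
  ; _≈_     = _≐_
  ; _+_     = _∪_
  ; _·_     = _∩_
  ; -_      = ∁
  ; 𝟙       = λ _ → ⊤
  ; 𝟘       = λ _ → ⊥
  ; cyl     = λ { Γ X (j , y) → ∃ λ z → X (j , z) × (∀ i → i ∉ Γ → lookup z i ≡ lookup y i) }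
  ; sub     = λ { τ X (j , y) → X (j , tabulate (λ i → lookup y (fun τ i))) }
  ; diag    = λ { i k (j , y) → lookup y i ≡ lookup y k }
  }

record CompletelyRepresentable {n : ℕ} (𝔄 : RawAlgebra (Fin n) ℓ ℓ) : Set (lsuc ℓ) where
  open RawAlgebra 𝔄
  field
    J          : Set ℓ
    B          : J → Set ℓ
    setAlgebra : Subalgebra (fullSetAlgebra n B) ℓ
    f          : Carrier → RawAlgebra.Carrier (Subalgebra.algebra setAlgebra)
    isIso      : IsIsomorphism 𝔄 (Subalgebra.algebra setAlgebra) f
    complete   : ∀ (X : Pred Carrier ℓ) b → IsSum X b →
                 proj₁ (f b) ≐ (λ v → ∃ λ x → X x × proj₁ (f x) v)

{-# OPTIONS --safe #-}
-- The summands of the representation are indexed by the atoms a of 𝔇.  The base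
-- of a is ω modulo i ~ j :⇔ a ≤ d_ij, and x ∈ A is sent to the set of those
-- tuples v with a ≤ s_v x.  An atom is a completely prime filter, so it turns a
-- sum in 𝔇 into a disjunction; what has to be shown is that s_v preserves sums.
-- As elements of Nr_n 𝔇 see only the first n values of v, the map v may be
-- exchanged for a composition of replacements [p / q] with p ≠ q.  Each of these
-- preserves sums because it has a conjugate, u ↦ c_p u · d_pq.  Applied to
-- c_k x = Σ_l s^k_l x this gives the witnesses for cylindrification, and applied
-- to the sums of 𝔄, which persist in 𝔇, it gives completeness.
module Submission where

open import Level using (Level)
open import Algebra.Lattice.Bundles using (BooleanAlgebra)
import Algebra.Lattice.Properties.BooleanAlgebra as BooleanAlgebraProperties
open import Axiom.ExcludedMiddle using (ExcludedMiddle)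
open import Data.Empty using (⊥-elim; ⊥-elim-irr)
open import Data.Fin.Base using (Fin; toℕ; fromℕ<)
open import Data.Fin.Properties using (toℕ<n; toℕ-fromℕ<; toℕ-injective; fromℕ<-toℕ) renaming (_≟_ to _≟ᶠ_)
open import Data.List.Base using (List; []; _∷_; [_]; _++_; filter; upTo; map)
open import Data.List.Membership.Propositional using (_∈_; _∉_)
open import Data.List.Membership.Propositional.Properties using (∈-filter⁺; ∈-upTo⁺; ∈-++⁺ˡ; ∈-++⁺ʳ; ∈-map⁺)
open import Data.List.Relation.Unary.All using (All; []; _∷_)
open import Data.List.Relation.Unary.All.Properties using (all-filter)
open import Data.List.Relation.Unary.Any using (here; there)
open import Data.Nat.Base using (ℕ; zero; suc; _≤_; _<_; z≤n; _⊔_) renaming (_+_ to _+ℕ_)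
open import Data.Nat.Induction using (<-rec)
open import Data.Nat.Properties using (_≟_; _<?_; _≤?_; <⇒≢; <⇒≤; <⇒≱; <-≤-trans; ≤-refl; ≮⇒≥; ≤∧≢⇒<; m≤n⇒m≤1+n; m≤m+n; m≤m⊔n; m≤n⊔m; m<1+n⇒m<n∨m≡n; +-cancelˡ-≡; anyUpTo?; <-cmp) renaming (≤-trans to ≤ℕ-trans)
open import Data.Product.Base using (Σ; ∃; _×_; _,_; proj₁; proj₂)
open import Data.Sum.Base using (_⊎_; inj₁; inj₂; [_,_]′)
import Data.Sum.Base as Sum
open import Data.Unit.Polymorphic.Base using (tt)
open import Data.Vec.Base using (Vec; lookup; tabulate; _[_]≔_)
open import Data.Vec.Properties using (lookup∘tabulate; lookup∘update; lookup∘update′)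
open import Function.Base using (id; _∘_; _$_)
open import Function.Bundles using (mk⇔)
open import Function.Definitions using (Injective)
open import Relation.Binary.Definitions using (tri<; tri≈; tri>)
open import Relation.Binary.PropositionalEquality using (_≡_; _≢_; refl; sym; trans; cong; subst; subst₂)
open import Relation.Nullary.Decidable.Core using (Dec; yes; no)
open import Relation.Nullary.Negation.Core using (¬_; contradiction)
open import Relation.Unary using (Pred; _⊆_; _≐_)
open import Defs

-- Finite transformations

replaceFun-≡ : ∀ k l → replaceFun k l k ≡ l
replaceFun-≡ k l with k ≟ k
... | yes _   = refl
... | no  k≢k = contradiction refl k≢k

replaceFun-≢ : ∀ {k} l {i} → i ≢ k → replaceFun k l i ≡ i
replaceFun-≢ {k} l {i} i≢k with i ≟ k
... | yes i≡k = contradiction i≡k i≢k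
... | no  _   = refl

updateFun : (ℕ → ℕ) → ℕ → ℕ → ℕ → ℕ
updateFun f k l i with i ≟ k
... | yes _ = l
... | no  _ = f i

updateFun-≡ : ∀ f k l → updateFun f k l k ≡ l
updateFun-≡ f k l with k ≟ k
... | yes _   = refl
... | no  k≢k = contradiction refl k≢k

updateFun-≢ : ∀ f {k} l {i} → i ≢ k → updateFun f k l i ≡ f i
updateFun-≢ f {k} l {i} i≢k with i ≟ k
... | yes i≡k = contradiction i≡k i≢k
... | no  _   = refl

update : FinTrans ℕ → ℕ → ℕ → FinTrans ℕ
update τ k l = record
  { fun     = updateFun (fun τ) k l
  ; support = k ∷ support τ
  ; fixes   = λ i i∉ → trans (updateFun-≢ (fun τ) l (i∉ ∘ here)) (fixes τ i (i∉ ∘ there))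
  }

-- The identity from `n` on is a default that makes the support finite; elements of `Nr n 𝔇` do not
-- see it, by `Nr-sub-agree`.
extendSeqFun : ∀ {n} → (Fin n → ℕ) → ℕ → ℕ
extendSeqFun {n} g i with i <? n
... | yes i<n = g (fromℕ< i<n)
... | no  _   = i

extendSeqFun-≥ : ∀ {n} (g : Fin n → ℕ) {i} → ¬ (i < n) → extendSeqFun g i ≡ i
extendSeqFun-≥ {n} g {i} i≮n with i <? n
... | yes i<n = contradiction i<n i≮n
... | no  _   = refl

extendSeqFun-toℕ : ∀ {n} (g : Fin n → ℕ) i → extendSeqFun g (toℕ i) ≡ g i
extendSeqFun-toℕ {n} g i with toℕ i <? n
... | yes i<n = cong g (fromℕ<-toℕ i i<n)
... | no  i≮n = contradiction (toℕ<n i) i≮n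

extendSeq : ∀ {n} → (Fin n → ℕ) → FinTrans ℕ
extendSeq {n} g = record
  { fun     = extendSeqFun g
  ; support = upTo n
  ; fixes   = λ i i∉ → extendSeqFun-≥ g (i∉ ∘ ∈-upTo⁺)
  }

extend-toℕ : ∀ {n} (τ : FinTrans (Fin n)) i → fun (extend τ) (toℕ i) ≡ toℕ (fun τ i)
extend-toℕ {n} τ i with toℕ i <? n
... | yes i<n = cong (toℕ ∘ fun τ) (fromℕ<-toℕ i i<n)
... | no  i≮n = contradiction (toℕ<n i) i≮n

-- Provides free indices above finitely many prescribed values.
bounded : ∀ (f : ℕ → ℕ) m → ∃ λ b → ∀ i → i < m → f i < b
bounded f zero    = 0 , λ _ ()
bounded f (suc m) with bounded f m
... | b , f<b = suc (f m) ⊔ b , λ i i<1+m →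
  [ (λ i<m → ≤ℕ-trans (f<b i i<m) (m≤n⊔m (suc (f m)) b))
  , (λ { refl → m≤m⊔n (suc (f m)) b }) ]′ (m<1+n⇒m<n∨m≡n i<1+m)

module _ {ℓ} (𝔇 : QEAω ℓ ℓ) where
  open QEAω 𝔇

  -- The Boolean order and sums

  booleanAlgebra : BooleanAlgebra ℓ ℓ
  booleanAlgebra = record { isBooleanAlgebra = isBooleanAlgebra }

  open BooleanAlgebra booleanAlgebra using (setoid)
    renaming (refl to ≈-refl; sym to ≈-sym; trans to ≈-trans;
      ∧-cong to ·-cong; ∨-cong to +-cong; ¬-cong to neg-cong; ∧-comm to ·-comm; ∧-assoc to ·-assoc;
      ∧-distribˡ-∨ to ·-distribˡ-+; ∧-complementʳ to ·-complementʳ; ∨-complementʳ to +-complementʳ;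
      ∧-absorbs-∨ to ·-absorbs-+; ∨-comm to +-comm)
  open BooleanAlgebraProperties booleanAlgebra using (¬-involutive; deMorgan₁; ¬⊤≈⊥)
    renaming (∧-identityʳ to ·-identityʳ; ∧-identityˡ to ·-identityˡ; ∧-zeroʳ to ·-zeroʳ;
      ∨-identityʳ to +-identityʳ; ∨-identityˡ to +-identityˡ; ∧-idem to ·-idem)
  open import Relation.Binary.Reasoning.Setoid setoid

  ·-congˡ : ∀ {x y z} → y ≈ z → x · y ≈ x · z
  ·-congˡ = ·-cong ≈-refl

  ·-congʳ : ∀ {x y z} → y ≈ z → y · x ≈ z · x
  ·-congʳ y≈z = ·-cong y≈z ≈-refl

  ≤-reflexive : ∀ {x y} → x ≈ y → x ≤ᴬ y
  ≤-reflexive {x} x≈y = ≈-trans (·-congˡ (≈-sym x≈y)) (·-idem x)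

  ≤-trans : ∀ {x y z} → x ≤ᴬ y → y ≤ᴬ z → x ≤ᴬ z
  ≤-trans {x} {y} {z} x≤y y≤z = begin
    x · z       ≈⟨ ·-congʳ x≤y ⟨
    (x · y) · z ≈⟨ ·-assoc x y z ⟩
    x · (y · z) ≈⟨ ·-congˡ y≤z ⟩
    x · y       ≈⟨ x≤y ⟩
    x           ∎

  ≤-respʳ-≈ : ∀ {x y z} → y ≈ z → x ≤ᴬ y → x ≤ᴬ z
  ≤-respʳ-≈ y≈z x≤y = ≤-trans x≤y (≤-reflexive y≈z)

  ≤-antisym : ∀ {x y} → x ≤ᴬ y → y ≤ᴬ x → x ≈ y
  ≤-antisym {x} {y} x≤y y≤x = ≈-trans (≈-sym x≤y) (≈-trans (·-comm x y) y≤x)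

  x·y≤y : ∀ x y → x · y ≤ᴬ y
  x·y≤y x y = ≈-trans (·-assoc x y y) (·-congˡ (·-idem y))

  x·y≤x : ∀ x y → x · y ≤ᴬ x
  x·y≤x x y = ≤-trans (≤-reflexive (·-comm x y)) (x·y≤y y x)

  ·-greatest : ∀ {x y z} → x ≤ᴬ y → x ≤ᴬ z → x ≤ᴬ y · z
  ·-greatest {x} {y} {z} x≤y x≤z = ≈-trans (≈-sym (·-assoc x y z)) (≈-trans (·-congʳ x≤y) x≤z)

  x≤x+y : ∀ x y → x ≤ᴬ x + y
  x≤x+y = ·-absorbs-+

  y≤x+y : ∀ x y → y ≤ᴬ x + y
  y≤x+y x y = ≤-respʳ-≈ (+-comm y x) (x≤x+y y x)

  x≤𝟙 : ∀ x → x ≤ᴬ 𝟙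
  x≤𝟙 = ·-identityʳ

  x≤𝟘⇒x≈𝟘 : ∀ {x} → x ≤ᴬ 𝟘 → x ≈ 𝟘
  x≤𝟘⇒x≈𝟘 {x} x≤𝟘 = ≈-trans (≈-sym x≤𝟘) (·-zeroʳ x)

  disjoint-mono : ∀ {x x′ y y′} → x ≤ᴬ x′ → y ≤ᴬ y′ → x′ · y′ ≈ 𝟘 → x · y ≈ 𝟘
  disjoint-mono {x} {y = y} x≤ y≤ x′y′≈𝟘 = x≤𝟘⇒x≈𝟘 (≤-respʳ-≈ x′y′≈𝟘
    (·-greatest (≤-trans (x·y≤x x y) x≤) (≤-trans (x·y≤y x y) y≤)))

  ≤-neg⇒disjoint : ∀ {x y} → x ≤ᴬ - y → x · y ≈ 𝟘
  ≤-neg⇒disjoint {x} {y} x≤-y =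
    disjoint-mono x≤-y (≤-reflexive ≈-refl) (≈-trans (·-comm (- y) y) (·-complementʳ y))

  disjoint-neg⇒≤ : ∀ {x y} → x · (- y) ≈ 𝟘 → x ≤ᴬ y
  disjoint-neg⇒≤ {x} {y} x-y≈𝟘 = begin
    x · y             ≈⟨ +-identityʳ (x · y) ⟨
    x · y + 𝟘         ≈⟨ +-cong ≈-refl x-y≈𝟘 ⟨
    x · y + x · (- y) ≈⟨ ·-distribˡ-+ x y (- y) ⟨
    x · (y + (- y))   ≈⟨ ·-congˡ (+-complementʳ y) ⟩
    x · 𝟙             ≈⟨ ·-identityʳ x ⟩
    x                 ∎

  disjoint⇒≤-neg : ∀ {x y} → x · y ≈ 𝟘 → x ≤ᴬ - y
  disjoint⇒≤-neg {x} {y} xy≈𝟘 = disjoint-neg⇒≤ (≈-trans (·-congˡ (¬-involutive y)) xy≈𝟘)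

  -- Disjointness from every element of `X` makes `- z` an upper bound of `X`, hence of `b`.
  sum-disjoint : ∀ {X : Pred Carrier ℓ} {b z} → IsSum X b → (∀ x → X x → z · x ≈ 𝟘) → z · b ≈ 𝟘
  sum-disjoint {b = b} {z} (_ , least) disjoint = ≈-trans (·-comm z b) (≤-neg⇒disjoint
    (least (- z) (λ x Xx → disjoint⇒≤-neg (≈-trans (·-comm x z) (disjoint x Xx)))))

  -- Atoms as prime filters

  module _ {a : Carrier} (atom : IsAtom a) where

    -- The element `a · x` lies below the atom `a`. Being a disjunction, this decides `a ≤ᴬ x`
    -- without excluded middle.
    atom-dichotomy : ∀ x → a ≤ᴬ x ⊎ a · x ≈ 𝟘
    atom-dichotomy x = Sum.swap (proj₂ atom (a · x) (x·y≤x a x))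

    atom-not-both : ∀ {x} → a ≤ᴬ x → ¬ (a · x ≈ 𝟘)
    atom-not-both a≤x ax≈𝟘 = proj₁ atom (≈-trans (≈-sym a≤x) ax≈𝟘)

    atom-≤? : ∀ x → Dec (a ≤ᴬ x)
    atom-≤? x with atom-dichotomy x
    ... | inj₁ a≤x  = yes a≤x
    ... | inj₂ ax≈𝟘 = no λ a≤x → atom-not-both a≤x ax≈𝟘

    atom-≰𝟘 : ¬ (a ≤ᴬ 𝟘)
    atom-≰𝟘 = proj₁ atom ∘ x≤𝟘⇒x≈𝟘

    atom-≤-neg : ∀ {x} → a ≤ᴬ - x → ¬ (a ≤ᴬ x)
    atom-≤-neg a≤-x a≤x = atom-not-both a≤x (≤-neg⇒disjoint a≤-x)

    atom-≰⇒≤-neg : ∀ {x} → ¬ (a ≤ᴬ x) → a ≤ᴬ - x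
    atom-≰⇒≤-neg {x} a≰x = [ (λ a≤x → contradiction a≤x a≰x) , disjoint⇒≤-neg ]′ (atom-dichotomy x)

    atom-prime : ∀ {x y} → a ≤ᴬ x + y → a ≤ᴬ x ⊎ a ≤ᴬ y
    atom-prime {x} {y} a≤x+y with atom-dichotomy x | atom-dichotomy y
    ... | inj₁ a≤x  | _         = inj₁ a≤x
    ... | _         | inj₁ a≤y  = inj₂ a≤y
    ... | inj₂ ax≈𝟘 | inj₂ ay≈𝟘 = contradiction
      (≈-trans (·-distribˡ-+ a x y) (≈-trans (+-cong ax≈𝟘 ay≈𝟘) (+-identityˡ 𝟘))) (atom-not-both a≤x+y)

  -- Cylindrifications, substitutions and diagonals

  cyl-congʳ : ∀ Γ {x y} → x ≈ y → cyl Γ x ≈ cyl Γ y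
  cyl-congʳ Γ = cyl-cong id id

  sub-congʳ : ∀ τ {x y} → x ≈ y → sub τ x ≈ sub τ y
  sub-congʳ τ = sub-cong {τ} {τ} (λ _ → refl)

  cyl-≈𝟘 : ∀ Γ {x} → x ≈ 𝟘 → cyl Γ x ≈ 𝟘
  cyl-≈𝟘 Γ x≈𝟘 = ≈-trans (cyl-congʳ Γ x≈𝟘) (cyl-𝟘 Γ)

  cyl-≈𝟘⁻ : ∀ Γ {x} → cyl Γ x ≈ 𝟘 → x ≈ 𝟘
  cyl-≈𝟘⁻ Γ {x} cx≈𝟘 = x≤𝟘⇒x≈𝟘 (≤-respʳ-≈ cx≈𝟘 (cyl-incr Γ x))

  sub-· : ∀ τ x y → sub τ (x · y) ≈ sub τ x · sub τ y
  sub-· τ x y = begin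
    sub τ (x · y)                  ≈⟨ ¬-involutive _ ⟨
    - (- sub τ (x · y))            ≈⟨ neg-cong (sub-neg τ (x · y)) ⟨
    - sub τ (- (x · y))            ≈⟨ neg-cong (sub-congʳ τ (deMorgan₁ x y)) ⟩
    - sub τ ((- x) + (- y))        ≈⟨ neg-cong (sub-+ τ (- x) (- y)) ⟩
    - (sub τ (- x) + sub τ (- y))  ≈⟨ neg-cong (+-cong (sub-neg τ x) (sub-neg τ y)) ⟩
    - ((- sub τ x) + (- sub τ y))  ≈⟨ neg-cong (deMorgan₁ (sub τ x) (sub τ y)) ⟨
    - (- (sub τ x · sub τ y))      ≈⟨ ¬-involutive _ ⟩
    sub τ x · sub τ y              ∎

  sub-mono : ∀ τ {x y} → x ≤ᴬ y → sub τ x ≤ᴬ sub τ y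
  sub-mono τ {x} {y} x≤y = ≈-trans (≈-sym (sub-· τ x y)) (sub-congʳ τ x≤y)

  -- Writing `𝟙` as `diag 0 0` makes `sub-diag` applicable; the index `0` is arbitrary.
  sub-𝟙 : ∀ τ → sub τ 𝟙 ≈ 𝟙
  sub-𝟙 τ = ≈-trans (sub-congʳ τ (≈-sym (diag-refl 0))) (≈-trans (sub-diag τ 0 0) (diag-refl _))

  sub-𝟘 : ∀ τ → sub τ 𝟘 ≈ 𝟘
  sub-𝟘 τ = begin
    sub τ 𝟘     ≈⟨ sub-congʳ τ ¬⊤≈⊥ ⟨
    sub τ (- 𝟙) ≈⟨ sub-neg τ 𝟙 ⟩
    - sub τ 𝟙   ≈⟨ neg-cong (sub-𝟙 τ) ⟩
    - 𝟙         ≈⟨ ¬⊤≈⊥ ⟩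
    𝟘           ∎

  -- The image of the axiom `diag-sub` under `sub τ`. It allows the value of `τ` at `i` to be
  -- exchanged for its value at `j` below the corresponding diagonal.
  diag-sub-∘ : ∀ τ i j x → sub τ x · diag (fun τ i) (fun τ j) ≤ᴬ sub (τ ∘T [ i / j ]) x
  diag-sub-∘ τ i j x = ≤-trans
    (≤-reflexive (≈-trans (·-congˡ (≈-sym (sub-diag τ i j))) (≈-sym (sub-· τ x (diag i j)))))
    (≤-respʳ-≈ (≈-sym (sub-∘ τ [ i / j ] x)) (sub-mono τ (diag-sub i j x)))

  -- The case of distinct indices 0, 1, 2 is diag-sub; a substitution carries it
  -- to arbitrary ones.
  diag-euclidean : ∀ p q r → diag p r · diag p q ≤ᴬ diag q r
  diag-euclidean p q r = ≤-trans
    (≤-reflexive (·-congʳ (≈-sym (sub-diag τ 0 2))))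
    (≤-respʳ-≈ (sub-diag (τ ∘T [ 0 / 1 ]) 0 2) (diag-sub-∘ τ 0 1 (diag 0 2)))
    where τ = update (update (update idT 0 p) 1 q) 2 r

  diag-sym : ∀ p q → diag p q ≤ᴬ diag q p
  diag-sym p q = ≤-trans (≤-reflexive (≈-trans (≈-sym (·-identityˡ _)) (·-congʳ (≈-sym (diag-refl p)))))
    (diag-euclidean p q p)

  diag-reflexive : ∀ {x i j} → i ≡ j → x ≤ᴬ diag i j
  diag-reflexive {x} {i} refl = ≤-respʳ-≈ (≈-sym (diag-refl i)) (x≤𝟙 x)

  diag-trans : ∀ {x i j k} → x ≤ᴬ diag i j → x ≤ᴬ diag j k → x ≤ᴬ diag i k
  diag-trans {i = i} {j} {k} x≤ij x≤jk =
    ≤-trans (·-greatest x≤jk (≤-trans x≤ij (diag-sym i j))) (diag-euclidean j i k)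

  -- Conjugates of substitutions

  -- `g` is a conjugate of `sub τ` in the sense of Jónsson and Tarski. Its existence forces `sub τ`
  -- to preserve all existing sums; `atom-sub-sum` is the form used here.
  HasConjugate : FinTrans ℕ → Set ℓ
  HasConjugate τ = ∃ λ (g : Carrier → Carrier) → ∀ u x →
    (u · sub τ x ≈ 𝟘 → g u · x ≈ 𝟘) × (g u · x ≈ 𝟘 → u · sub τ x ≈ 𝟘)

  hasConjugate-id : HasConjugate idT
  hasConjugate-id = id , λ u x →
    ≈-trans (·-congˡ (≈-sym (sub-id x))) , ≈-trans (·-congˡ (sub-id x))

  hasConjugate-∘ : ∀ {σ τ} → HasConjugate σ → HasConjugate τ → HasConjugate (σ ∘T τ)
  hasConjugate-∘ {σ} {τ} (g , conj-g) (h , conj-h) = h ∘ g , λ u x →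
    (λ eq → proj₁ (conj-h (g u) x) (proj₁ (conj-g u (sub τ x))
              (≈-trans (·-congˡ (≈-sym (sub-∘ σ τ x))) eq))) ,
    (λ eq → ≈-trans (·-congˡ (sub-∘ σ τ x))
              (proj₂ (conj-g u (sub τ x)) (proj₂ (conj-h (g u) x) eq)))

  -- One inequality is `diag-sub` for `x`; the other is `diag-sub` for `- x`, as substitutions
  -- commute with complements.
  sub-replace-diag : ∀ p q x → x · diag p q ≈ sub [ p / q ] x · diag p q
  sub-replace-diag p q x = ≤-antisym
    (·-greatest (diag-sub p q x) (x·y≤y x _))
    (·-greatest (disjoint-neg⇒≤ sub-x·d·-x≈𝟘) (x·y≤y _ _))
    where
    sub-x·d·-x≈𝟘 : (sub [ p / q ] x · diag p q) · (- x) ≈ 𝟘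
    sub-x·d·-x≈𝟘 = begin
      (sub [ p / q ] x · diag p q) · (- x) ≈⟨ ·-assoc _ _ _ ⟩
      sub [ p / q ] x · (diag p q · (- x)) ≈⟨ ·-comm _ _ ⟩
      (diag p q · (- x)) · sub [ p / q ] x ≈⟨ ≤-neg⇒disjoint
        (≤-trans (≤-reflexive (·-comm _ _)) (≤-respʳ-≈ (sub-neg [ p / q ] x) (diag-sub p q (- x)))) ⟩
      𝟘                                    ∎

  -- Since `p ≢ q`, no index is sent to `p`. The preimage of `[ p ]` is therefore empty, and
  -- `cyl-sub` turns the cylindrification into `cyl []`.
  cyl-sub-replace : ∀ {p q} → p ≢ q → ∀ x → cyl [ p ] (sub [ p / q ] x) ≈ sub [ p / q ] x
  cyl-sub-replace {p} {q} p≢q x = ≈-trans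
    (cyl-sub [ p / q ] [ p ] [] x (λ i → mk⇔ (λ ()) (avoids i)) (λ _ _ ()))
    (sub-congʳ [ p / q ] (cyl-empty x))
    where
    avoids : ∀ i → replaceFun p q i ∈ [ p ] → i ∈ []
    avoids i (here eq) with i ≟ p
    ... | yes _   = contradiction (sym eq) p≢q
    ... | no  i≢p = contradiction eq i≢p

  module _ (cylIsSum : CylIsSumOfSubs 𝔇) where

    -- Among the elements with sum `cyl [ p ] (diag p q)` is `sub [ p / q ] (diag p q)`, which is
    -- `diag q q` and hence `𝟙`.
    cyl-diag : ∀ p q → cyl [ p ] (diag p q) ≈ 𝟙
    cyl-diag p q = ≤-antisym (x≤𝟙 _) (proj₁ (cylIsSum (diag p q) p) 𝟙 (q , ≈-sym sub-diag≈𝟙))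
      where
      diag≈𝟙 : ∀ {i j} → i ≡ j → diag i j ≈ 𝟙
      diag≈𝟙 refl = diag-refl _
      fixes-q : replaceFun p q q ≡ q
      fixes-q with q ≟ p
      ... | yes _ = refl
      ... | no  _ = refl
      sub-diag≈𝟙 : sub [ p / q ] (diag p q) ≈ 𝟙
      sub-diag≈𝟙 = ≈-trans (sub-diag [ p / q ] p q)
        (diag≈𝟙 (trans (replaceFun-≡ p q) (sym fixes-q)))

    -- The key identity is `g u · x ≈ d · c (u · s x)`: below `d`, `x` and `s x` coincide, and `s x`
    -- passes through `c` because it is `c`-closed. As `c d ≈ 𝟙`, the right side vanishes only if
    -- `c (u · s x)` does.
    hasConjugate-replace : ∀ {p q} → p ≢ q → HasConjugate [ p / q ]
    hasConjugate-replace {p} {q} p≢q = g , λ u x → conj⇒ u x , conj⇐ u x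
      where
      c = cyl [ p ]
      s = sub [ p / q ]
      d = diag p q

      g : Carrier → Carrier
      g u = c u · d

      c[u·sx] : ∀ u x → c (u · s x) ≈ c u · s x
      c[u·sx] u x = begin
        c (u · s x)     ≈⟨ cyl-congʳ [ p ] (·-congˡ (cyl-sub-replace p≢q x)) ⟨
        c (u · c (s x)) ≈⟨ cyl-· [ p ] u (s x) ⟩
        c u · c (s x)   ≈⟨ ·-congˡ (cyl-sub-replace p≢q x) ⟩
        c u · s x       ∎

      g[u]·x : ∀ u x → g u · x ≈ d · c (u · s x)
      g[u]·x u x = begin
        (c u · d) · x   ≈⟨ ·-assoc _ _ _ ⟩
        c u · (d · x)   ≈⟨ ·-congˡ (·-comm d x) ⟩
        c u · (x · d)   ≈⟨ ·-congˡ (sub-replace-diag p q x) ⟩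
        c u · (s x · d) ≈⟨ ·-assoc _ _ _ ⟨
        (c u · s x) · d ≈⟨ ·-comm _ d ⟩
        d · (c u · s x) ≈⟨ ·-congˡ (c[u·sx] u x) ⟨
        d · c (u · s x) ∎

      conj⇒ : ∀ u x → u · s x ≈ 𝟘 → g u · x ≈ 𝟘
      conj⇒ u x eq = ≈-trans (g[u]·x u x) (≈-trans (·-congˡ (cyl-≈𝟘 [ p ] eq)) (·-zeroʳ d))

      conj⇐ : ∀ u x → g u · x ≈ 𝟘 → u · s x ≈ 𝟘
      conj⇐ u x eq = cyl-≈𝟘⁻ [ p ] (begin
        c (u · s x)       ≈⟨ ·-identityˡ _ ⟨
        𝟙 · c (u · s x)   ≈⟨ ·-congʳ (cyl-diag p q) ⟨
        c d · c (u · s x) ≈⟨ cyl-· [ p ] d (u · s x) ⟨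
        c (d · c (u · s x)) ≈⟨ cyl-≈𝟘 [ p ] (≈-trans (≈-sym (g[u]·x u x)) eq) ⟩
        𝟘                 ∎)

    -- The points s 0, …, s (n - 1) can be moved one after the other because no
    -- target t i is moved again.
    conjugate-moving : ∀ (s t : ℕ → ℕ) → Injective _≡_ _≡_ s → ∀ n →
      (∀ i j → i < n → j < n → t i ≢ s j) →
      ∃ λ τ → HasConjugate τ × (∀ i → i < n → fun τ (s i) ≡ t i) × (∀ i → n ≤ i → fun τ (s i) ≡ s i)
    conjugate-moving s t s-inj zero    t≢s = idT , hasConjugate-id , (λ _ ()) , λ _ _ → refl
    conjugate-moving s t s-inj (suc n) t≢s
      with conjugate-moving s t s-inj n (λ i j i<n j<n → t≢s i j (m≤n⇒m≤1+n i<n) (m≤n⇒m≤1+n j<n))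
    ... | τ , conj , moved , fixed =
      [ s n / t n ] ∘T τ ,
      hasConjugate-∘ (hasConjugate-replace (λ eq → t≢s n n ≤-refl ≤-refl (sym eq))) conj ,
      (λ i i<1+n → [ moved-before i i<1+n , (λ { refl → moved-now }) ]′ (m<1+n⇒m<n∨m≡n i<1+n)) ,
      still-fixed
      where
      σ = [ s n / t n ]
      moved-before : ∀ i → i < suc n → i < n → fun σ (fun τ (s i)) ≡ t i
      moved-before i i<1+n i<n = trans (cong (fun σ) (moved i i<n))
        (replaceFun-≢ (t n) (t≢s i n i<1+n ≤-refl))
      moved-now : fun σ (fun τ (s n)) ≡ t n
      moved-now = trans (cong (fun σ) (fixed n ≤-refl)) (replaceFun-≡ (s n) (t n))
      still-fixed : ∀ i → suc n ≤ i → fun σ (fun τ (s i)) ≡ s i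
      still-fixed i n<i = trans (cong (fun σ) (fixed i (<⇒≤ n<i)))
        (replaceFun-≢ (t n) (λ eq → <⇒≢ n<i (sym (s-inj eq))))

    -- The points below n are first moved out of the way, above n and all values
    -- of t, and then to their destinations.
    conjugate-agreeing : ∀ (t : ℕ → ℕ) n →
      ∃ λ τ → HasConjugate τ × (∀ i → i < n → fun τ i ≡ t i)
    conjugate-agreeing t n with bounded t n
    ... | b , t<b =
      σ₂ ∘T σ₁ , hasConjugate-∘ conj₂ conj₁ ,
      λ i i<n → trans (cong (fun σ₂) (moved₁ i i<n)) (moved₂ i i<n)
      where
      k = n ⊔ b
      away : ∀ {i} → i < k → ∀ j → i ≢ k +ℕ j
      away i<k j = <⇒≢ (<-≤-trans i<k (m≤m+n k j))
      first : ∃ λ τ → HasConjugate τ × (∀ i → i < n → fun τ i ≡ k +ℕ i) × (∀ i → n ≤ i → fun τ i ≡ i)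
      first = conjugate-moving id (k +ℕ_) id n
        (λ i j _ j<n eq → away (<-≤-trans j<n (m≤m⊔n n b)) i (sym eq))
      second : ∃ λ τ → HasConjugate τ × (∀ i → i < n → fun τ (k +ℕ i) ≡ t i) ×
                                        (∀ i → n ≤ i → fun τ (k +ℕ i) ≡ k +ℕ i)
      second = conjugate-moving (k +ℕ_) t (+-cancelˡ-≡ k _ _) n
        (λ i j i<n _ → away (<-≤-trans (t<b i i<n) (m≤n⊔m n b)) j)
      σ₁     = proj₁ first
      conj₁  = proj₁ (proj₂ first)
      moved₁ = proj₁ (proj₂ (proj₂ first))
      σ₂     = proj₁ second
      conj₂  = proj₁ (proj₂ second)
      moved₂ = proj₁ (proj₂ (proj₂ second))

  -- If `a` were below no `sub τ x`, it would be disjoint from all of them. Then `g a` would be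
  -- disjoint from every `x` in `X`, hence from `b`, and conjugacy would make `a` disjoint from
  -- `sub τ b`.
  atom-sub-sum : ExcludedMiddle ℓ → ∀ {a} → IsAtom a → ∀ {τ} → HasConjugate τ →
    ∀ {X : Pred Carrier ℓ} {b} → IsSum X b → a ≤ᴬ sub τ b → ∃ λ x → X x × a ≤ᴬ sub τ x
  atom-sub-sum em {a} atom {τ} (g , conj) {X} {b} isSum a≤ with em {∃ λ x → X x × a ≤ᴬ sub τ x}
  ... | yes found = found
  ... | no  none  = contradiction (proj₂ (conj a b) (sum-disjoint isSum g[a]·x≈𝟘)) (atom-not-both atom a≤)
    where
    g[a]·x≈𝟘 : ∀ x → X x → g a · x ≈ 𝟘
    g[a]·x≈𝟘 x Xx = [ (λ a≤x → contradiction (x , Xx , a≤x) none) , proj₁ (conj a x) ]′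
      (atom-dichotomy atom (sub τ x))

  -- Elements of the neat reduct

  module _ {n : ℕ} {x : Carrier} (x∈Nr : Nr n 𝔇 x) where

    Nr-cyl : ∀ {Γ} → All (n ≤_) Γ → cyl Γ x ≈ x
    Nr-cyl []                  = cyl-empty x
    Nr-cyl {i ∷ Γ} (n≤i ∷ n≤Γ) = begin
      cyl (i ∷ Γ) x       ≈⟨ cyl-union [ i ] Γ x ⟨
      cyl [ i ] (cyl Γ x) ≈⟨ cyl-congʳ [ i ] (Nr-cyl n≤Γ) ⟩
      cyl [ i ] x         ≈⟨ x∈Nr i n≤i ⟩
      x                   ∎

    -- From `n` on, the two maps can differ only on their finite supports. These indices form `Γ`,
    -- and `x` is closed under `cyl Γ`, so `sub-cyl` applies.
    Nr-sub-agree : ∀ σ τ → (∀ i → i < n → fun σ i ≡ fun τ i) → sub σ x ≈ sub τ x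
    Nr-sub-agree σ τ agree = begin
      sub σ x         ≈⟨ sub-congʳ σ cyl-x ⟨
      sub σ (cyl Γ x) ≈⟨ sub-cyl σ τ Γ x agree-off-Γ ⟩
      sub τ (cyl Γ x) ≈⟨ sub-congʳ τ cyl-x ⟩
      sub τ x         ∎
      where
      Γ : List ℕ
      Γ = filter (n ≤?_) (support σ ++ support τ)
      cyl-x : cyl Γ x ≈ x
      cyl-x = Nr-cyl (all-filter (n ≤?_) (support σ ++ support τ))
      agree-off-Γ : ∀ i → i ∉ Γ → fun σ i ≡ fun τ i
      agree-off-Γ i i∉Γ with i <? n
      ... | yes i<n = agree i i<n
      ... | no  i≮n = trans (fixes σ i (i∉ ∘ ∈-++⁺ˡ)) (sym (fixes τ i (i∉ ∘ ∈-++⁺ʳ (support σ))))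
        where
        i∉ : i ∉ support σ ++ support τ
        i∉ i∈ = i∉Γ (∈-filter⁺ (n ≤?_) i∈ (≮⇒≥ i≮n))

    module _ {a : Carrier} where

      -- The index n, invisible to x, is used to store the new value.
      Nr-sub-step : ∀ τ m l → m < n → a ≤ᴬ diag (fun τ m) l → a ≤ᴬ sub τ x → a ≤ᴬ sub (update τ m l) x
      Nr-sub-step τ m l m<n a≤diag a≤ = ≤-respʳ-≈ (Nr-sub-agree (τ⁺ ∘T [ m / n ]) (update τ m l) agree)
        (≤-trans (·-greatest (≤-respʳ-≈ (Nr-sub-agree τ τ⁺ (λ i i<n → sym (below i i<n))) a≤) a≤diag⁺)
          (diag-sub-∘ τ⁺ m n x))
        where
        τ⁺ = update τ n l
        below : ∀ i → i < n → fun τ⁺ i ≡ fun τ i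
        below i i<n = updateFun-≢ (fun τ) l (<⇒≢ i<n)
        a≤diag⁺ : a ≤ᴬ diag (fun τ⁺ m) (fun τ⁺ n)
        a≤diag⁺ rewrite below m m<n | updateFun-≡ (fun τ) n l = a≤diag
        agree : ∀ i → i < n → fun τ⁺ (replaceFun m n i) ≡ updateFun (fun τ) m l i
        agree i i<n with i ≟ m
        ... | yes _ = updateFun-≡ (fun τ) n l
        ... | no  _ = below i i<n

      -- The values are exchanged one at a time, from `n - 1` down to `0`, by `Nr-sub-step`. In
      -- `change`, the indices from `m` to `n - 1` are already done, which is vacuous at the start.
      -- This makes membership in the representation independent of the choice of representatives.
      Nr-sub-diag : ∀ σ τ → (∀ i → i < n → a ≤ᴬ diag (fun σ i) (fun τ i)) → a ≤ᴬ sub σ x → a ≤ᴬ sub τ x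
      Nr-sub-diag σ₀ τ a≤diag = change n ≤-refl σ₀ (λ i i<n n≤i → contradiction n≤i (<⇒≱ i<n)) a≤diag
        where
        change : ∀ m → m ≤ n → ∀ σ → (∀ i → i < n → m ≤ i → fun σ i ≡ fun τ i) →
          (∀ i → i < m → a ≤ᴬ diag (fun σ i) (fun τ i)) → a ≤ᴬ sub σ x → a ≤ᴬ sub τ x
        change zero    _   σ agree _   a≤ = ≤-respʳ-≈ (Nr-sub-agree σ τ (λ i i<n → agree i i<n z≤n)) a≤
        change (suc m) m<n σ agree rel a≤ = change m (<⇒≤ m<n) (update σ m (fun τ m)) agree′ rel′
          (Nr-sub-step σ m (fun τ m) m<n (rel m ≤-refl) a≤)
          where
          agree′ : ∀ i → i < n → m ≤ i → updateFun (fun σ) m (fun τ m) i ≡ fun τ i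
          agree′ i i<n m≤i with i ≟ m
          ... | yes refl = refl
          ... | no  i≢m  = agree i i<n (≤∧≢⇒< m≤i (i≢m ∘ sym))
          rel′ : ∀ i → i < m → a ≤ᴬ diag (updateFun (fun σ) m (fun τ m) i) (fun τ i)
          rel′ i i<m = subst (λ j → a ≤ᴬ diag j (fun τ i)) (sym (updateFun-≢ (fun σ) (fun τ m) (<⇒≢ i<m)))
            (rel i (m≤n⇒m≤1+n i<m))

  -- The quotient of ℕ by i ~ j :⇔ a ≤ diag i j, as the set of least
  -- representatives; irrelevance makes elements with equal index equal.
  record Class (a : Carrier) : Set ℓ where
    constructor class
    field
      index  : ℕ
      .least : ∀ m → m < index → ¬ (a ≤ᴬ diag m index)

  open Class

  module _ {a : Carrier} where

    -- Of two distinct equivalent indices, the smaller would refute the minimality of the larger.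
    Class-separated : (p q : Class a) → a ≤ᴬ diag (index p) (index q) → p ≡ q
    Class-separated (class i i-least) (class j j-least) i~j with <-cmp i j
    ... | tri< i<j _ _  = ⊥-elim-irr (j-least i i<j i~j)
    ... | tri≈ _ refl _ = refl
    ... | tri> _ _ j<i  = ⊥-elim-irr (i-least j j<i (≤-trans i~j (diag-sym i j)))

    -- Well-founded recursion: either some smaller index is equivalent to `k` and its class serves,
    -- or `k` itself is least. The search is decidable by `atom-≤?`.
    classOf : IsAtom a → ∀ k → ∃ λ (p : Class a) → a ≤ᴬ diag k (index p)
    classOf atom = <-rec _ λ k rec → step k (λ m m<k → rec {m} m<k) (anyUpTo? (λ m → atom-≤? atom (diag m k)) k)
      where
      step : ∀ k → (∀ m → m < k → ∃ λ (p : Class a) → a ≤ᴬ diag m (index p)) →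
        Dec (∃ λ m → m < k × a ≤ᴬ diag m k) → ∃ λ (p : Class a) → a ≤ᴬ diag k (index p)
      step k rec (yes (m , m<k , m~k)) with rec m m<k
      ... | p , m~p = p , diag-trans (≤-trans m~k (diag-sym m k)) m~p
      step k rec (no none) = class k (λ m m<k m~k → none (m , m<k , m~k)) , diag-reflexive refl

  -- The representation

  module Representation (em : ExcludedMiddle ℓ) (atomic : Atomic) (cylIsSum : CylIsSumOfSubs 𝔇)
    (n : ℕ) (𝔄 : Subalgebra (reduct n 𝔇) ℓ) (A⊆Nr : Subalgebra.Universe 𝔄 ⊆ Nr n 𝔇)
    (A⊆c : IsCompleteSubalgebra 𝔄) where
    open Subalgebra 𝔄 using (Universe)
    private
      module 𝔄 = RawAlgebra (Subalgebra.algebra 𝔄)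
      module S = Subalgebra 𝔄

    J : Set ℓ
    J = Σ Carrier IsAtom

    B : J → Set ℓ
    B (a , _) = Class a

    private
      module 𝔖 = RawAlgebra (fullSetAlgebra n B)

    assign : ∀ {a} → Vec (Class a) n → FinTrans ℕ
    assign v = extendSeq (index ∘ lookup v)

    rep : 𝔄.Carrier → 𝔖.Carrier
    rep (x , _) ((a , _) , v) = a ≤ᴬ sub (assign v) x

    assign-toℕ : ∀ {a} (v : Vec (Class a) n) i → fun (assign v) (toℕ i) ≡ index (lookup v i)
    assign-toℕ v = extendSeqFun-toℕ (index ∘ lookup v)

    below-n : ∀ {q} (P : ℕ → Set q) → (∀ (k : Fin n) → P (toℕ k)) → ∀ i → i < n → P i
    below-n P Ptoℕ i i<n = subst P (toℕ-fromℕ< i<n) (Ptoℕ (fromℕ< i<n))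

    -- Preservation of the operations

    rep-cong : ∀ {x y} → x 𝔄.≈ y → rep x 𝔖.≈ rep y
    rep-cong x≈y = (λ {(_ , v)} → ≤-respʳ-≈ (sub-congʳ (assign v) x≈y)) ,
                   (λ {(_ , v)} → ≤-respʳ-≈ (sub-congʳ (assign v) (≈-sym x≈y)))

    rep-+ : ∀ x y → rep (x 𝔄.+ y) 𝔖.≈ (rep x 𝔖.+ rep y)
    rep-+ (x , _) (y , _) =
      (λ {((_ , atom) , v)} a≤ → atom-prime atom (≤-respʳ-≈ (sub-+ (assign v) x y) a≤)) ,
      (λ {(_ , v)} → [ (λ a≤x → ≤-trans a≤x (sub-mono (assign v) (x≤x+y x y)))
                     , (λ a≤y → ≤-trans a≤y (sub-mono (assign v) (y≤x+y x y))) ]′)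

    rep-· : ∀ x y → rep (x 𝔄.· y) 𝔖.≈ (rep x 𝔖.· rep y)
    rep-· (x , _) (y , _) =
      (λ {(_ , v)} a≤ → ≤-trans a≤ (sub-mono (assign v) (x·y≤x x y)) ,
                        ≤-trans a≤ (sub-mono (assign v) (x·y≤y x y))) ,
      (λ {(_ , v)} (a≤x , a≤y) → ≤-respʳ-≈ (≈-sym (sub-· (assign v) x y)) (·-greatest a≤x a≤y))

    rep-neg : ∀ x → rep (𝔄.- x) 𝔖.≈ (𝔖.- rep x)
    rep-neg (x , _) =
      (λ {((_ , atom) , v)} a≤ → atom-≤-neg atom (≤-respʳ-≈ (sub-neg (assign v) x) a≤)) ,
      (λ {((_ , atom) , v)} a≰ → ≤-respʳ-≈ (≈-sym (sub-neg (assign v) x)) (atom-≰⇒≤-neg atom a≰))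

    rep-𝟙 : rep 𝔄.𝟙 𝔖.≈ 𝔖.𝟙
    rep-𝟙 = (λ _ → tt) , (λ {(_ , v)} _ → ≤-respʳ-≈ (≈-sym (sub-𝟙 (assign v))) (x≤𝟙 _))

    rep-𝟘 : rep 𝔄.𝟘 𝔖.≈ 𝔖.𝟘
    rep-𝟘 = (λ {((_ , atom) , v)} a≤ → ⊥-elim (atom-≰𝟘 atom (≤-respʳ-≈ (sub-𝟘 (assign v)) a≤))) , (λ ())

    rep-sub : ∀ τ x → rep (𝔄.sub τ x) 𝔖.≈ 𝔖.sub τ (rep x)
    rep-sub τ (x , x∈A) = (λ {(_ , v)} → ≤-respʳ-≈ (sub-assign v)) ,
                          (λ {(_ , v)} → ≤-respʳ-≈ (≈-sym (sub-assign v)))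
      where
      sub-assign : ∀ {a} (v : Vec (Class a) n) →
        sub (assign v) (sub (extend τ) x) ≈ sub (assign (tabulate (λ i → lookup v (fun τ i)))) x
      sub-assign v = ≈-trans (≈-sym (sub-∘ (assign v) (extend τ) x))
        (Nr-sub-agree (A⊆Nr x∈A) (assign v ∘T extend τ) (assign (tabulate (λ i → lookup v (fun τ i)))) $
          below-n _ λ k → trans (cong (fun (assign v)) (extend-toℕ τ k))
            (trans (assign-toℕ v (fun τ k))
              (sym (trans (assign-toℕ (tabulate (λ i → lookup v (fun τ i))) k)
                (cong index (lookup∘tabulate (λ i → lookup v (fun τ i)) k))))))

    rep-diag : ∀ i k → rep (𝔄.diag i k) 𝔖.≈ 𝔖.diag i k
    rep-diag i k =
      (λ {(_ , v)} a≤ → Class-separated (lookup v i) (lookup v k) (≤-respʳ-≈ (sub-assign v) a≤)) ,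
      (λ {(_ , v)} v≡ → ≤-respʳ-≈ (≈-sym (sub-assign v)) (diag-reflexive (cong index v≡)))
      where
      sub-assign : ∀ {a} (v : Vec (Class a) n) →
        sub (assign v) (diag (toℕ i) (toℕ k)) ≈ diag (index (lookup v i)) (index (lookup v k))
      sub-assign v = subst₂ (λ l m → sub (assign v) (diag (toℕ i) (toℕ k)) ≈ diag l m)
        (assign-toℕ v i) (assign-toℕ v k) (sub-diag (assign v) (toℕ i) (toℕ k))

    -- Once `assign v` is exchanged for a `τ` with a conjugate, the sum defining the
    -- cylindrification can be split: `a` lies below `sub τ` of one summand `sub [ toℕ i / l ] y`.
    cyl-witness : ∀ i x {j} v → rep (𝔄.cyl [ i ] x) (j , v) → ∃ λ p → rep x (j , v [ i ]≔ p)
    cyl-witness i (y , y∈A) {a , atom} v a≤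
      with conjugate-agreeing cylIsSum (fun (assign v)) n
    ... | τ , conj , agree
      with atom-sub-sum em atom conj (cylIsSum y (toℕ i))
             (≤-respʳ-≈ (≈-sym (Nr-sub-agree (A⊆Nr (S.cyl-closed [ i ] y∈A)) τ (assign v) agree)) a≤)
    -- The composite sends `toℕ i` to `fun τ l`, so the class of that value is the new coordinate.
    -- As `l` may be at least `n`, it need not be the value of `assign v` at `l`.
    ... | _ , (l , z≈) , a≤z with classOf atom (fun τ l)
    ... | p , τl~p = p , Nr-sub-diag (A⊆Nr y∈A) σ (assign (v [ i ]≔ p)) (below-n _ related)
                       (≤-respʳ-≈ (≈-trans (sub-congʳ τ z≈) (≈-sym (sub-∘ τ [ toℕ i / l ] y))) a≤z)
      where
      σ = τ ∘T [ toℕ i / l ]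
      related : ∀ k → a ≤ᴬ diag (fun σ (toℕ k)) (fun (assign (v [ i ]≔ p)) (toℕ k))
      related k rewrite assign-toℕ (v [ i ]≔ p) k with k ≟ᶠ i
      ... | yes refl rewrite replaceFun-≡ (toℕ i) l | lookup∘update i v p = τl~p
      ... | no  k≢i  rewrite replaceFun-≢ l (k≢i ∘ toℕ-injective) | lookup∘update′ k≢i v p =
        diag-reflexive (trans (agree (toℕ k) (toℕ<n k)) (assign-toℕ v k))

    -- By `cyl-union`, the coordinates listed in `Γ` are changed one after the other, each by
    -- `cyl-witness`.
    rep-cyl⁺ : ∀ Γ x {j} v → rep (𝔄.cyl Γ x) (j , v) → 𝔖.cyl Γ (rep x) (j , v)
    rep-cyl⁺ []      (x , _) v a≤ = v , ≤-respʳ-≈ (sub-congʳ (assign v) (cyl-empty x)) a≤ , λ _ _ → refl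
    rep-cyl⁺ (i ∷ Γ) x {j} v a≤ = combine (cyl-witness i (𝔄.cyl Γ x) {j} v
      (≤-respʳ-≈ (sub-congʳ (assign v) (≈-sym (cyl-union [ toℕ i ] (map toℕ Γ) (proj₁ x)))) a≤))
      where
      combine : (∃ λ p → rep (𝔄.cyl Γ x) (j , v [ i ]≔ p)) → 𝔖.cyl (i ∷ Γ) (rep x) (j , v)
      combine (p , a≤p) = let z , a≤z , z≡ = rep-cyl⁺ Γ x {j} (v [ i ]≔ p) a≤p in
        z , a≤z , λ k k∉ → trans (z≡ k (k∉ ∘ there)) (lookup∘update′ (k∉ ∘ here) v p)

    -- The transformations of `z` and `v` coincide off `Γ`, so `sub-cyl` identifies their actions on
    -- `cyl (map toℕ Γ) x`.
    rep-cyl⁻ : ∀ Γ x {j} v → 𝔖.cyl Γ (rep x) (j , v) → rep (𝔄.cyl Γ x) (j , v)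
    rep-cyl⁻ Γ (x , _) v (z , a≤z , z≡) =
      ≤-respʳ-≈ (sub-cyl (assign z) (assign v) (map toℕ Γ) x agree)
        (≤-trans a≤z (sub-mono (assign z) (cyl-incr (map toℕ Γ) x)))
      where
      agree : ∀ i → i ∉ map toℕ Γ → fun (assign z) i ≡ fun (assign v) i
      agree i i∉ with i <? n
      ... | yes i<n = cong index (z≡ (fromℕ< i<n) λ i∈ →
                        i∉ (subst (_∈ map toℕ Γ) (toℕ-fromℕ< i<n) (∈-map⁺ toℕ i∈)))
      ... | no  _   = refl

    rep-cyl : ∀ Γ x → rep (𝔄.cyl Γ x) 𝔖.≈ 𝔖.cyl Γ (rep x)
    rep-cyl Γ x = (λ {(j , v)} → rep-cyl⁺ Γ x {j} v) , (λ {(j , v)} → rep-cyl⁻ Γ x {j} v)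

    -- Injectivity

    canonical : (j : J) → Vec (B j) n
    canonical (_ , atom) = tabulate λ i → proj₁ (classOf atom (toℕ i))

    canonical-related : ∀ j i → i < n → proj₁ j ≤ᴬ diag i (fun (assign (canonical j)) i)
    canonical-related j@(a , atom) = below-n _ λ k →
      subst (λ m → a ≤ᴬ diag (toℕ k) m)
        (sym (trans (assign-toℕ (canonical j) k) (cong index (lookup∘tabulate _ k))))
        (proj₂ (classOf atom (toℕ k)))

    -- The canonical tuple is the identity sequence modulo the diagonals above the atom, so its
    -- substitution can be exchanged for `idT`.
    rep-canonical⁺ : ∀ j x → proj₁ j ≤ᴬ proj₁ x → rep x (j , canonical j)
    rep-canonical⁺ j (x , x∈A) a≤x =
      Nr-sub-diag (A⊆Nr x∈A) idT (assign (canonical j)) (canonical-related j)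
        (≤-respʳ-≈ (≈-sym (sub-id x)) a≤x)

    rep-canonical⁻ : ∀ j x → rep x (j , canonical j) → proj₁ j ≤ᴬ proj₁ x
    rep-canonical⁻ j (x , x∈A) a≤ = ≤-respʳ-≈ (sub-id x)
      (Nr-sub-diag (A⊆Nr x∈A) (assign (canonical j)) idT
        (λ i i<n → ≤-trans (canonical-related j i i<n) (diag-sym _ _)) a≤)

    -- Otherwise atomicity of `𝔇` gives an atom below `x` and the complement of `y`; its canonical
    -- tuple lies in `rep x` but not in `rep y`.
    rep-reflects-≤ : ∀ x y → rep x ⊆ rep y → x 𝔄.≤ᴬ y
    rep-reflects-≤ x y rx⊆ry with em {proj₁ x · (- proj₁ y) ≈ 𝟘}
    ... | yes x-y≈𝟘 = disjoint-neg⇒≤ x-y≈𝟘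
    ... | no  x-y≉𝟘 with atomic _ x-y≉𝟘
    ... | a , atom , a≤ = contradiction
      (rep-canonical⁻ (a , atom) y (rx⊆ry {(a , atom) , canonical (a , atom)} (rep-canonical⁺ (a , atom) x (≤-trans a≤ (x·y≤x _ _)))))
      (atom-≤-neg atom (≤-trans a≤ (x·y≤y _ _)))

    -- Persistence of sums with value 𝟙 gives persistence of all sums, on adding
    -- the complement of the sum.
    sum-persists : ∀ (X : Pred 𝔄.Carrier ℓ) b → 𝔄.IsSum X b →
      IsSum (λ y → Σ (Universe y) λ y∈A → X (y , y∈A)) (proj₁ b)
    sum-persists X (b , b∈A) (upper , least) =
      (λ { y (y∈A , Xy) → upper (y , y∈A) Xy }) , below
      where
      Y : Pred Carrier ℓ
      Y y = (Σ (Universe y) λ y∈A → X (y , y∈A)) ⊎ y ≈ - b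

      Y⊆A : Y ⊆ Universe
      Y⊆A (inj₁ (y∈A , _)) = y∈A
      Y⊆A (inj₂ y≈-b)      = S.respects (≈-sym y≈-b) (S.neg-closed b∈A)

      𝟙-least : ∀ u → (∀ y → Y (proj₁ y) → y 𝔄.≤ᴬ u) → 𝔄.𝟙 𝔄.≤ᴬ u
      𝟙-least (u , u∈A) bound = ≤-trans (≤-reflexive (≈-sym (+-complementʳ b))) b+-b≤u
        where
        b≤u : b ≤ᴬ u
        b≤u = least (u , u∈A) (λ { (y , y∈A) Xy → bound (y , y∈A) (inj₁ (y∈A , Xy)) })
        -b≤u : (- b) ≤ᴬ u
        -b≤u = bound (- b , S.neg-closed b∈A) (inj₂ ≈-refl)
        b+-b≤u : (b + (- b)) ≤ᴬ u
        b+-b≤u = begin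
          (b + (- b)) · u     ≈⟨ ·-comm _ u ⟩
          u · (b + (- b))     ≈⟨ ·-distribˡ-+ u b (- b) ⟩
          u · b + u · (- b)   ≈⟨ +-cong (·-comm u b) (·-comm u (- b)) ⟩
          b · u + (- b) · u   ≈⟨ +-cong b≤u -b≤u ⟩
          b + (- b)           ∎

      Y-sum : IsSum Y 𝟙
      Y-sum = A⊆c Y Y⊆A ((λ _ _ → x≤𝟙 _) , 𝟙-least)

      -- A bound `u` of `X` in `𝔇` may lie outside `𝔄`. Since `u + (- b)` bounds `Y`, it is above
      -- `𝟙`, and meeting with `b` leaves `b · u ≈ b`.
      below : ∀ u → (∀ y → (Σ (Universe y) λ y∈A → X (y , y∈A)) → y ≤ᴬ u) → b ≤ᴬ u
      below u bound = begin
        b · u               ≈⟨ +-identityʳ _ ⟨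
        b · u + 𝟘           ≈⟨ +-cong ≈-refl (·-complementʳ b) ⟨
        b · u + b · (- b)   ≈⟨ ·-distribˡ-+ b u (- b) ⟨
        b · (u + (- b))     ≈⟨ ≤-trans (x≤𝟙 b) (proj₂ Y-sum (u + (- b)) Y-bound) ⟩
        b                   ∎
        where
        Y-bound : ∀ y → Y y → y ≤ᴬ u + (- b)
        Y-bound y (inj₁ Xy)   = ≤-trans (bound y Xy) (x≤x+y u (- b))
        Y-bound y (inj₂ y≈-b) = ≤-trans (≤-reflexive y≈-b) (y≤x+y u (- b))

    -- For the inclusion from left to right, `assign v` is exchanged for a map with a conjugate, the
    -- persisting sum is split by `atom-sub-sum`, and the map is exchanged back. The converse is
    -- monotonicity.
    rep-sum : ∀ (X : Pred 𝔄.Carrier ℓ) b → 𝔄.IsSum X b →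
      rep b ≐ (λ v → ∃ λ x → X x × rep x v)
    rep-sum X b@(_ , b∈A) isSum = (λ {(j , v)} → to j v) ,
      (λ { {_ , v} (x , Xx , a≤) → ≤-trans a≤ (sub-mono (assign v) (proj₁ isSum x Xx)) })
      where
      to : ∀ j v → rep b (j , v) → ∃ λ x → X x × rep x (j , v)
      to (a , atom) v a≤ with conjugate-agreeing cylIsSum (fun (assign v)) n
      ... | τ , conj , agree
        with atom-sub-sum em atom conj (sum-persists X b isSum)
               (≤-respʳ-≈ (≈-sym (Nr-sub-agree (A⊆Nr b∈A) τ (assign v) agree)) a≤)
      ... | x , (x∈A , Xx) , a≤x =
        (x , x∈A) , Xx , ≤-respʳ-≈ (Nr-sub-agree (A⊆Nr x∈A) τ (assign v) agree) a≤x

    -- The image as a set algebra and the isomorphism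

    ≐-sym : ∀ {P Q : 𝔖.Carrier} → P ≐ Q → Q ≐ P
    ≐-sym (P⊆Q , Q⊆P) = Q⊆P , P⊆Q

    ≐-trans : ∀ {P Q R : 𝔖.Carrier} → P ≐ Q → Q ≐ R → P ≐ R
    ≐-trans (P⊆Q , Q⊆P) (Q⊆R , R⊆Q) = (λ p → Q⊆R (P⊆Q p)) , (λ r → Q⊆P (R⊆Q r))

    image : Subalgebra (fullSetAlgebra n B) ℓ
    image = record
      { Universe    = λ P → ∃ λ x → P ≐ rep x
      ; respects    = λ P≐Q (x , P≐) → x , ≐-trans (≐-sym P≐Q) P≐
      ; +-closed    = λ (x , P≐) (y , Q≐) → x 𝔄.+ y ,
          ≐-trans (Sum.map (proj₁ P≐) (proj₁ Q≐) , Sum.map (proj₂ P≐) (proj₂ Q≐)) (≐-sym (rep-+ x y))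
      ; ·-closed    = λ (x , P≐) (y , Q≐) → x 𝔄.· y ,
          ≐-trans ((λ (p , q) → proj₁ P≐ p , proj₁ Q≐ q) , (λ (p , q) → proj₂ P≐ p , proj₂ Q≐ q))
            (≐-sym (rep-· x y))
      ; neg-closed  = λ (x , P≐) → 𝔄.- x ,
          ≐-trans ((λ ¬p r → ¬p (proj₂ P≐ r)) , (λ ¬r p → ¬r (proj₁ P≐ p))) (≐-sym (rep-neg x))
      ; 𝟙-closed    = 𝔄.𝟙 , ≐-sym rep-𝟙
      ; 𝟘-closed    = 𝔄.𝟘 , ≐-sym rep-𝟘
      ; cyl-closed  = λ Γ (x , P≐) → 𝔄.cyl Γ x ,
          ≐-trans ((λ (z , p , z≡) → z , proj₁ P≐ p , z≡) , (λ (z , p , z≡) → z , proj₂ P≐ p , z≡))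
            (≐-sym (rep-cyl Γ x))
      ; sub-closed  = λ τ (x , P≐) → 𝔄.sub τ x ,
          ≐-trans ((λ p → proj₁ P≐ p) , (λ p → proj₂ P≐ p)) (≐-sym (rep-sub τ x))
      ; diag-closed = λ i k → 𝔄.diag i k , ≐-sym (rep-diag i k)
      }

    completelyRepresentable : CompletelyRepresentable (Subalgebra.algebra 𝔄)
    completelyRepresentable = record
      { J          = J
      ; B          = B
      ; setAlgebra = image
      ; f          = λ x → rep x , x , id , id
      ; isIso      = record
        { congruent  = λ {x} {y} → rep-cong {x} {y}
        ; injective  = λ {x} {y} (rx⊆ry , ry⊆rx) →
            ≤-antisym (rep-reflects-≤ x y (λ {v} → rx⊆ry {v})) (rep-reflects-≤ y x (λ {v} → ry⊆rx {v}))
        ; surjective = λ (P , x , P≐) → x , λ {z} z≈x → ≐-trans (rep-cong {z} {x} z≈x) (≐-sym P≐)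
        ; +-homo     = rep-+
        ; ·-homo     = rep-·
        ; neg-homo   = rep-neg
        ; 𝟙-homo     = rep-𝟙
        ; 𝟘-homo     = rep-𝟘
        ; cyl-homo   = rep-cyl
        ; sub-homo   = rep-sub
        ; diag-homo  = rep-diag
        }
      ; complete   = rep-sum
      }

mainTheorem8 : ∀ {ℓ : Level} → ExcludedMiddle ℓ →
    (n : ℕ) (𝔇 : QEAω ℓ ℓ) → QEAω.Atomic 𝔇 → CylIsSumOfSubs 𝔇 →
    (𝔄 : Subalgebra (reduct n 𝔇) ℓ) → Subalgebra.Universe 𝔄 ⊆ Nr n 𝔇 →
    IsCompleteSubalgebra 𝔄 → CompletelyRepresentable (Subalgebra.algebra 𝔄)
mainTheorem8 em n 𝔇 atomic cylIsSum 𝔄 A⊆Nr A⊆c =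
  Representation.completelyRepresentable 𝔇 em atomic cylIsSum n 𝔄 A⊆Nr A⊆c
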